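{- For every integer $n\ge 3$, $\hat{A}_{\Sigma}(n) \leq 3n-6$.
   Context: For a finite set $\mathcal P \subset \mathbb{R}^2$ and $p \in \mathcal P$, $A_p(\mathcal P)$ denotes the number of distinct values in $(0,\pi)$ of angles $\angle q p r$ with center (vertex) $p$ and $q,r \in \mathcal P\setminus\{p\}$ distinct. Define $$\hat{A}_{\Sigma}(n) := \min_{|\mathcal{P}| = n}\ \sum_{p \in \mathcal P} A_p(\mathcal{P}),$$ where the minimum is over all sets $\mathcal{P}\subset\mathbb{R}^2$ of $n$ points that are not all collinear. -}

module Defs where

open import Algebra.Bundles using (CommutativeRing)
open import Data.Fin.Base using (Fin)
import Data.Fin.Properties as Fin
open import Data.List.Base
  using (List; map; filter; deduplicate; length; sum; tabulate; allFin; cartesianProduct)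
import Data.Nat.Base as ℕ
open import Data.Nat.Base using (ℕ)
open import Data.Product.Base using (_×_; _,_; proj₁; proj₂; ∃; ∃-syntax)
open import Data.Sum.Base using (_⊎_; inj₁; inj₂)
open import Function.Definitions using (Injective)
open import Level using (0ℓ; suc)
open import Relation.Binary.Core using (Rel)
open import Relation.Binary.Bundles using (StrictTotalOrder)
open import Relation.Binary.Definitions using (tri<; tri≈; tri>)
open import Relation.Binary.Structures using (IsStrictTotalOrder)
import Relation.Binary.Construct.StrictToNonStrict as ToNonStrict
open import Relation.Binary.PropositionalEquality.Core using (_≡_)
open import Relation.Nullary.Decidable using (¬?; _×-dec_)
open import Relation.Nullary.Negation using (¬_; contradiction)
open import Relation.Unary using (Pred)

-- Up to isomorphism, the field ℝ of classical real analysis is the only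
-- model.  Equality is the setoid equality _≈_, so ℝ may be presented without
-- quotients.
record CompleteOrderedField : Set (suc 0ℓ) where
  infix  4 _<_
  infix  8 _⁻¹
  field
    commutativeRing    : CommutativeRing 0ℓ 0ℓ
  open CommutativeRing commutativeRing public hiding (_≉_)
  field
    -- The value of 0# ⁻¹ is unspecified.
    _⁻¹                : Carrier → Carrier
    ⁻¹-cong            : ∀ {x y} → x ≈ y → x ⁻¹ ≈ y ⁻¹
    *-inverseʳ         : ∀ {x} → ¬ x ≈ 0# → x * x ⁻¹ ≈ 1#
    _<_                : Rel Carrier 0ℓ
    isStrictTotalOrder : IsStrictTotalOrder _≈_ _<_
    0<1                : 0# < 1#
    +-monoˡ-<          : ∀ z {x y} → x < y → x + z < y + z
    *-pos              : ∀ {x y} → 0# < x → 0# < y → 0# < x * y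

  open ToNonStrict _≈_ _<_ public using (_≤_)
  module Order = IsStrictTotalOrder isStrictTotalOrder

  UpperBound : Pred Carrier 0ℓ → Pred Carrier 0ℓ
  UpperBound P b = ∀ {x} → P x → x ≤ b

  -- The second clause is the ε-form of "no b < s is an upper bound"; it
  -- implies s ≤ b for every upper bound b, is classically equivalent to it, and
  -- lets excluded middle (for Set) be derived, so minima over ℕ exist.
  IsSupremum : Pred Carrier 0ℓ → Pred Carrier 0ℓ
  IsSupremum P s = UpperBound P s × (∀ {b} → b < s → ∃[ x ] P x × b < x)

  field
    complete : (P : Pred Carrier 0ℓ) → ∃ P → ∃ (UpperBound P) → ∃ (IsSupremum P)

module OrderedFieldProperties (ℝ : CompleteOrderedField) where
  open CompleteOrderedField ℝ

  strictTotalOrder : StrictTotalOrder 0ℓ 0ℓ 0ℓ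
  strictTotalOrder = record { isStrictTotalOrder = isStrictTotalOrder }

  open import Relation.Binary.Properties.StrictTotalOrder strictTotalOrder public
    using (decTotalOrder)
  open import Relation.Binary.Bundles using (DecTotalOrder)
  open DecTotalOrder decTotalOrder public
    using (total; antisym)
    renaming (refl to ≤-refl; trans to ≤-trans; reflexive to ≤-reflexive)
  open import Algebra.Properties.Ring ring public
    using (-‿distribˡ-*; -‿distribʳ-*; -‿involutive; -0#≈0#)
  open import Relation.Binary.Reasoning.Setoid setoid

  <-resp : ∀ {x x′ y y′} → x ≈ x′ → y ≈ y′ → x < y → x′ < y′
  <-resp p q x<y = Order.<-respˡ-≈ p (Order.<-respʳ-≈ q x<y)

  ≤-resp : ∀ {x x′ y y′} → x ≈ x′ → y ≈ y′ → x ≤ y → x′ ≤ y′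
  ≤-resp p q x≤y = ≤-trans (≤-reflexive (sym p)) (≤-trans x≤y (≤-reflexive q))

  <⇒≱ : ∀ {x y} → x < y → ¬ y ≤ x
  <⇒≱ x<y (inj₁ y<x) = Order.asym x<y y<x
  <⇒≱ x<y (inj₂ y≈x) = Order.irrefl (sym y≈x) x<y

  ≤-<-trans : ∀ {x y z} → x ≤ y → y < z → x < z
  ≤-<-trans (inj₁ x<y) y<z = Order.trans x<y y<z
  ≤-<-trans (inj₂ x≈y) y<z = Order.<-respˡ-≈ (sym x≈y) y<z

  +-monoˡ-≤ : ∀ z {x y} → x ≤ y → x + z ≤ y + z
  +-monoˡ-≤ z (inj₁ x<y) = inj₁ (+-monoˡ-< z x<y)
  +-monoˡ-≤ z (inj₂ x≈y) = inj₂ (+-congʳ x≈y)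

  +-mono-≤ : ∀ {x y u v} → x ≤ y → u ≤ v → x + u ≤ y + v
  +-mono-≤ {x} {y} {u} {v} x≤y u≤v = ≤-trans (+-monoˡ-≤ u x≤y)
    (≤-resp (+-comm u y) (+-comm v y) (+-monoˡ-≤ y u≤v))

  cancel : ∀ x y → (y - x) + x ≈ y
  cancel x y = begin
    (y - x) + x    ≈⟨ +-assoc y (- x) x ⟩
    y + (- x + x)  ≈⟨ +-congˡ (-‿inverseˡ x) ⟩
    y + 0#         ≈⟨ +-identityʳ y ⟩
    y              ∎

  x<y⇒0<y-x : ∀ {x y} → x < y → 0# < y - x
  x<y⇒0<y-x {x} x<y = Order.<-respˡ-≈ (-‿inverseʳ x) (+-monoˡ-< (- x) x<y)

  0<y-x⇒x<y : ∀ {x y} → 0# < y - x → x < y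
  0<y-x⇒x<y {x} {y} p = <-resp (+-identityˡ x) (cancel x y) (+-monoˡ-< x p)

  x≤y⇒0≤y-x : ∀ {x y} → x ≤ y → 0# ≤ y - x
  x≤y⇒0≤y-x {x} x≤y = ≤-resp (-‿inverseʳ x) refl (+-monoˡ-≤ (- x) x≤y)

  *-distribʳ-- : ∀ z x y → (y - x) * z ≈ y * z - x * z
  *-distribʳ-- z x y = trans (distribʳ z y (- x)) (+-congˡ (sym (-‿distribˡ-* x z)))

  *-distribˡ-- : ∀ z x y → z * (y - x) ≈ z * y - z * x
  *-distribˡ-- z x y = trans (distribˡ z y (- x)) (+-congˡ (sym (-‿distribʳ-* z x)))

  *-monoˡ-< : ∀ {x y z} → 0# < z → x < y → x * z < y * z
  *-monoˡ-< {x} {y} {z} 0<z x<y = 0<y-x⇒x<y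
    (Order.<-respʳ-≈ (*-distribʳ-- z x y) (*-pos (x<y⇒0<y-x x<y) 0<z))

  *-monoˡ-≤ : ∀ {x y z} → 0# ≤ z → x ≤ y → x * z ≤ y * z
  *-monoˡ-≤ 0≤z (inj₂ x≈y) = inj₂ (*-congʳ x≈y)
  *-monoˡ-≤ (inj₁ 0<z) (inj₁ x<y) = inj₁ (*-monoˡ-< 0<z x<y)
  *-monoˡ-≤ {x} {y} (inj₂ 0≈z) _ = inj₂ (trans (zero′ x) (sym (zero′ y)))
    where
    zero′ : ∀ w → w * _ ≈ 0#
    zero′ w = trans (*-congˡ (sym 0≈z)) (zeroʳ w)

  1≤x<y⇒x<y² : ∀ {x y} → 1# ≤ x → x < y → x < y * y
  1≤x<y⇒x<y² {x} {y} 1≤x x<y =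
    Order.trans x<y (Order.<-respˡ-≈ (*-identityˡ y) (*-monoˡ-< 0<y 1<y))
    where
    1<y : 1# < y
    1<y = ≤-<-trans 1≤x x<y
    0<y : 0# < y
    0<y = Order.trans 0<1 1<y

  x²≥0 : ∀ x → 0# ≤ x * x
  x²≥0 x with Order.compare x 0#
  ... | tri> _ _ 0<x = inj₁ (*-pos 0<x 0<x)
  ... | tri≈ _ x≈0 _ = inj₂ (sym (trans (*-congʳ x≈0) (zeroˡ x)))
  ... | tri< x<0 _ _ = inj₁ (Order.<-respʳ-≈ -x*-x≈x*x (*-pos 0<-x 0<-x))
    where
    0<-x : 0# < - x
    0<-x = Order.<-respʳ-≈ (+-identityˡ (- x)) (x<y⇒0<y-x x<0)
    -x*-x≈x*x : - x * - x ≈ x * x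
    -x*-x≈x*x = begin
      - x * - x    ≈⟨ -‿distribˡ-* x (- x) ⟨
      - (x * - x)  ≈⟨ -‿cong (-‿distribʳ-* x x) ⟨
      - - (x * x)  ≈⟨ -‿involutive (x * x) ⟩
      x * x        ∎

  commonUpperBound : ∀ x y → ∃[ b ] x ≤ b × y ≤ b
  commonUpperBound x y with total x y
  ... | inj₁ x≤y = y , x≤y , ≤-refl
  ... | inj₂ y≤x = x , ≤-refl , y≤x

module RealFunctions (ℝ : CompleteOrderedField) where
  open CompleteOrderedField ℝ
  open OrderedFieldProperties ℝ

  -- The set has supremum √x for 0 ≤ x; the disjunct y ≤ 0 makes it nonempty
  -- for every x, so that √x = 0 for x < 0.
  SqrtSet : Carrier → Pred Carrier 0ℓ
  SqrtSet x y = y ≤ 0# ⊎ y * y ≤ x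

  sqrtSet-bounded : ∀ {x b} → 1# ≤ b → x ≤ b → UpperBound (SqrtSet x) b
  sqrtSet-bounded 1≤b x≤b (inj₁ y≤0) = ≤-trans y≤0 (≤-trans (inj₁ 0<1) 1≤b)
  sqrtSet-bounded {x} {b} 1≤b x≤b {y} (inj₂ y²≤x) with Order.compare y b
  ... | tri< y<b _ _ = inj₁ y<b
  ... | tri≈ _ y≈b _ = inj₂ y≈b
  ... | tri> _ _ b<y =
    contradiction (≤-trans y²≤x x≤b) (<⇒≱ (1≤x<y⇒x<y² 1≤b b<y))

  sqrt-sup : ∀ x → ∃ (IsSupremum (SqrtSet x))
  sqrt-sup x = complete (SqrtSet x) (0# , inj₁ ≤-refl)
    (let b , 1≤b , x≤b = commonUpperBound 1# x in b , sqrtSet-bounded 1≤b x≤b)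

  √ : Carrier → Carrier
  √ x = proj₁ (sqrt-sup x)

  -- LowerSum f a b s: s is the integral over [a , b] of a step function
  -- lying below f there.
  data LowerSum (f : Carrier → Carrier) : (a b s : Carrier) → Set where
    done : ∀ {a b} → a ≈ b → LowerSum f a b 0#
    step : ∀ {a b s} c m → a ≤ c → (∀ t → a ≤ t → t ≤ c → m ≤ f t) →
           LowerSum f c b s → LowerSum f a b (m * (c - a) + s)

  lowerSum-bounded : ∀ {f M a b s} → (∀ t → f t ≤ M) →
                     LowerSum f a b s → s ≤ M * (b - a)
  lowerSum-bounded {M = M} {a} {b} f≤M (done a≈b) = ≤-reflexive (sym
    (trans (*-congˡ (trans (+-congˡ (-‿cong a≈b)) (-‿inverseʳ b))) (zeroʳ M)))
  lowerSum-bounded {M = M} {a} {b} f≤M (step c m a≤c m≤f ls) = ≤-resp refl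
    (trans (sym (distribˡ M (c - a) (b - c))) (*-congˡ telescope))
    (+-mono-≤ (*-monoˡ-≤ (x≤y⇒0≤y-x a≤c) (≤-trans (m≤f a ≤-refl a≤c) (f≤M a)))
              (lowerSum-bounded f≤M ls))
    where
    telescope : (c - a) + (b - c) ≈ b - a
    telescope = trans (+-comm (c - a) (b - c))
      (trans (sym (+-assoc (b - c) c (- a))) (+-congʳ (cancel c b)))

  LowerSums : (f : Carrier → Carrier) (a b : Carrier) → Pred Carrier 0ℓ
  LowerSums f a b s = s ≈ 0# ⊎ LowerSum f a b s

  integral-sup : ∀ f → ∃[ M ] (∀ t → f t ≤ M) → ∀ a b →
                 ∃ (IsSupremum (LowerSums f a b))
  integral-sup f (M , f≤M) a b = complete (LowerSums f a b) (0# , inj₁ refl)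
    (let B , 0≤B , M≤B = commonUpperBound 0# (M * (b - a)) in
     B , λ { (inj₁ s≈0) → ≤-trans (≤-reflexive s≈0) 0≤B
           ; (inj₂ ls)  → ≤-trans (lowerSum-bounded f≤M ls) M≤B })

  -- The Darboux integral of a nonnegative (integrable) f over [a , b].
  -- For such f and a ≤ b the value 0 added in LowerSums is already a lower
  -- sum; it only serves to give the junk value 0 when b < a.
  integral : ∀ f → ∃[ M ] (∀ t → f t ≤ M) → (a b : Carrier) → Carrier
  integral f bdd a b = proj₁ (integral-sup f bdd a b)

  semicircle : Carrier → Carrier
  semicircle t = √ (1# - t * t)

  semicircle≤1 : ∀ t → semicircle t ≤ 1#
  semicircle≤1 t with Order.compare (semicircle t) 1#
  ... | tri< p _ _ = inj₁ p
  ... | tri≈ _ p _ = inj₂ p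
  ... | tri> _ _ p =
    let y , y∈S , 1<y = proj₂ (proj₂ (sqrt-sup (1# - t * t))) p
    in contradiction (sqrtSet-bounded ≤-refl 1-t²≤1 y∈S) (<⇒≱ 1<y)
    where
    1-t²≤1 : 1# - t * t ≤ 1#
    1-t²≤1 = ≤-resp (+-identityˡ _) (cancel (t * t) 1#)
      (≤-trans (+-monoˡ-≤ (1# - t * t) (x²≥0 t)) (≤-reflexive (+-comm (t * t) _)))

  ∫semicircle : (a b : Carrier) → Carrier
  ∫semicircle = integral semicircle (1# , semicircle≤1)

  2# : Carrier
  2# = 1# + 1#

  π : Carrier
  π = 2# * ∫semicircle (- 1#) 1#

  -- For - 1 ≤ x ≤ 1, twice the area of the sector of the unit disc between the
  -- positive first axis and the ray through (x , √(1 - x²)), that is, the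
  -- radian measure of the angle in [0 , π] whose cosine is x.
  arccos : Carrier → Carrier
  arccos x = x * semicircle x + 2# * ∫semicircle x 1#

module Angles (ℝ : CompleteOrderedField) where
  open CompleteOrderedField ℝ
  open RealFunctions ℝ

  Point : Set
  Point = Carrier × Carrier

  infix 4 _≈ₚ_
  _≈ₚ_ : Rel Point 0ℓ
  (x , y) ≈ₚ (x′ , y′) = x ≈ x′ × y ≈ y′

  infixl 6 _-ₚ_
  _-ₚ_ : Point → Point → Point
  (x , y) -ₚ (x′ , y′) = x - x′ , y - y′

  infixl 7 _·_
  _·_ : Point → Point → Carrier
  (x , y) · (x′ , y′) = x * x′ + y * y′

  ‖_‖ : Point → Carrier
  ‖ u ‖ = √ (u · u)

  -- The vertex is the middle argument; meaningful when q and r differ from p.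
  ∠ : (q p r : Point) → Carrier
  ∠ q p r = arccos ((u · v) * (‖ u ‖ * ‖ v ‖) ⁻¹)
    where
    u = q -ₚ p
    v = r -ₚ p

  Collinear : ∀ {n} → (Fin n → Point) → Set
  Collinear P = ∃[ a ] ∃[ b ] ∃[ c ] ¬ (a ≈ 0# × b ≈ 0#) ×
    (∀ i → a * proj₁ (P i) + b * proj₂ (P i) ≈ c)

  module _ {n} (P : Fin n → Point) where

    anglesAt : Fin n → List Carrier
    anglesAt i = map (λ (j , k) → ∠ (P j) (P i) (P k))
      (filter (λ (j , k) → ¬? (j Fin.≟ i) ×-dec ¬? (k Fin.≟ i) ×-dec ¬? (j Fin.≟ k))
        (cartesianProduct (allFin n) (allFin n)))

    A : Fin n → ℕ
    A i = length (deduplicate Order._≟_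
      (filter (λ θ → (0# Order.<? θ) ×-dec (θ Order.<? π)) (anglesAt i)))

    AΣ : ℕ
    AΣ = sum (tabulate A)

  -- A set of n points is given by an injective enumeration.
  IsAngleSum : ℕ → Pred ℕ 0ℓ
  IsAngleSum n s = ∃[ P ] Injective {A = Fin n} _≡_ _≈ₚ_ P × ¬ Collinear P × AΣ P ≡ s

  IsMinimum : Pred ℕ 0ℓ → Pred ℕ 0ℓ
  IsMinimum S m = S m × (∀ s → S s → m ℕ.≤ s)

  -- m is the value ÂΣ(n).
  IsÂΣ : ℕ → Pred ℕ 0ℓ
  IsÂΣ n = IsMinimum (IsAngleSum n)

{-# OPTIONS --safe #-}
module Submission where

-- The extremal configuration consists of an apex and n − 1 points on a line
-- that are seen from the apex at equal angular steps.  The apex then sees at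
-- most n − 2 angles.  A vertex on the line sees only 0, π and the angles between
-- the apex and the two directions of the line, of which the first and the last
-- point have just one: altogether (n − 2) + 2 (n − 3) + 1 + 1 = 3n − 6.  The
-- equal steps come from a rotation with rational cosine and sine, so no
-- trigonometric functions are needed: an angle between unit vectors a and b is
-- arccos (a · b), and the dot product of two points of an orbit depends only on
-- the difference of their indices.

open import Defs
open import Algebra.Bundles using (CommutativeRing; RawRing)
import Algebra.Solver.Ring as RingSolver
open import Algebra.Solver.Ring.AlmostCommutativeRing
  using (fromCommutativeRing; _-Raw-AlmostCommutative⟶_; Induced-equivalence)
open import Data.Fin.Base as Fin using (Fin; toℕ; fromℕ; fromℕ<)
import Data.Fin.Properties as Fin
open import Data.List.Base using (List; []; _∷_; length; lookup; filter; tabulate; allFin; cartesianProduct)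
open import Data.List.Membership.Propositional.Properties using (∈-lookup)
import Data.List.Membership.Setoid as Membership
open import Data.List.Membership.Setoid.Properties using (index-injective; ∈-resp-≈)
open import Data.List.Properties using (length-tabulate)
open import Data.List.Relation.Unary.All as All using (All)
import Data.List.Relation.Unary.All.Properties as All
open import Data.List.Relation.Unary.AllPairs using (_∷_)
open import Data.List.Relation.Unary.Any as Any using (here; there)
import Data.List.Relation.Unary.Any.Properties as Any
open import Data.List.Relation.Unary.Unique.DecSetoid.Properties using (deduplicate-!)
open import Data.List.Relation.Unary.Unique.Setoid using (Unique)
import Data.Maybe.Base as Maybe
import Data.Nat.Base as ℕ
open import Data.Nat.Base using (ℕ)
open import Data.Nat.ListAction using (sum)
import Data.Nat.Properties as ℕ
open import Data.Nat.Solver using (module +-*-Solver)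
open import Data.Product.Base using (_×_; _,_; proj₁; proj₂; ∃-syntax)
open import Data.Product.Properties using (≡-dec)
open import Data.Sum.Base using (_⊎_; inj₁; inj₂; [_,_]′)
open import Function.Base using (_∘_)
open import Function.Definitions using (Injective)
open import Relation.Binary.Bundles using (StrictTotalOrder)
open import Relation.Binary.Definitions using (WeaklyDecidable; tri<; tri≈; tri>)
open import Relation.Binary.PropositionalEquality.Core as ≡ using (_≡_; _≢_)
open import Relation.Nullary.Decidable using (Dec; yes; no; dec⇒maybe; ¬?; _×-dec_)
open import Relation.Nullary.Negation using (¬_; contradiction)

-- Arithmetic of indices and counts

sum-tabulate-≤ : ∀ m {f : Fin (ℕ.suc m) → ℕ} → (∀ i → f i ℕ.≤ 2) → f (fromℕ m) ℕ.≤ 1 →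
  sum (tabulate f) ℕ.≤ 1 ℕ.+ m ℕ.* 2
sum-tabulate-≤ ℕ.zero    f≤2 last≤1 = ℕ.+-mono-≤ last≤1 ℕ.z≤n
sum-tabulate-≤ (ℕ.suc m) f≤2 last≤1 = ℕ.≤-trans
  (ℕ.+-mono-≤ (f≤2 Fin.zero) (sum-tabulate-≤ m (f≤2 ∘ Fin.suc) last≤1))
  (ℕ.≤-reflexive (ℕ.+-suc 2 (m ℕ.* 2)))

-- The successor form `suc d` matches the indexing of `0<y` and of the list of apex angles, where
-- `d` starts at 0.
gap : ∀ {i j} → i ℕ.< j → ∃[ d ] i ℕ.+ ℕ.suc d ≡ j
gap {i} i<j with ℕ.m≤n⇒∃[o]m+o≡n i<j
... | d , eq = d , ≡.trans (ℕ.+-suc i d) eq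

gap≤ : ∀ {i j k} (i<j : i ℕ.< j) → j ℕ.≤ k → ℕ.suc (proj₁ (gap i<j)) ℕ.≤ k
gap≤ {i} i<j = ℕ.≤-trans (≡.subst (ℕ.suc (proj₁ (gap i<j)) ℕ.≤_) (proj₂ (gap i<j)) (ℕ.m≤n+m _ i))

angle-count : ∀ m → ℕ.suc m ℕ.+ (1 ℕ.+ (1 ℕ.+ m ℕ.* 2)) ≡ 3 ℕ.* (3 ℕ.+ m) ℕ.∸ 6
angle-count m = ≡.sym (≡.trans (≡.cong (ℕ._∸ 6) (ℕ.*-distribˡ-+ 3 3 m))
  (solve 1 (λ m → con 3 :+ con 3 :* m := con 1 :+ m :+ (con 1 :+ (con 1 :+ m :* con 2))) ≡.refl m))
  where open +-*-Solver

-- Both sides are the maximum of `m` and `n`.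
n+[m∸n]≡m+[n∸m] : ∀ m n → n ℕ.+ (m ℕ.∸ n) ≡ m ℕ.+ (n ℕ.∸ m)
n+[m∸n]≡m+[n∸m] ℕ.zero    n         = ≡.trans (≡.cong (n ℕ.+_) (ℕ.0∸n≡0 n)) (ℕ.+-identityʳ n)
n+[m∸n]≡m+[n∸m] (ℕ.suc m) ℕ.zero    = ≡.sym (ℕ.+-identityʳ (ℕ.suc m))
n+[m∸n]≡m+[n∸m] (ℕ.suc m) (ℕ.suc n) = ≡.cong ℕ.suc (n+[m∸n]≡m+[n∸m] m n)

-- The pair (a , b) stands for the integer coefficient a − b; operations return
-- reduced pairs (one entry is 0), so that equal coefficients have equal codes.
module IntegerCoefficients {c ℓ} (R : CommutativeRing c ℓ) where
  open CommutativeRing R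
  open import Algebra.Properties.Ring ring using (-0#≈0#; x[y-z]≈xy-xz; [y-z]x≈yx-zx)
  open import Algebra.Properties.AbelianGroup +-abelianGroup using (⁻¹-anti-homo‿-; ⁻¹-∙-comm)
  open import Algebra.Properties.CommutativeSemigroup (CommutativeRing.+-commutativeSemigroup R)
    using (interchange)
  open import Algebra.Properties.Semiring.Mult semiring using (×-homo-+; ×1-homo-*; ×-congˡ)
    renaming (_×_ to _×′_)
  open import Relation.Binary.Reasoning.Setoid setoid

  reduce : ℕ × ℕ → ℕ × ℕ
  reduce (a , b) = a ℕ.∸ b , b ℕ.∸ a

  _+ᶜ_ _*ᶜ_ : ℕ × ℕ → ℕ × ℕ → ℕ × ℕ
  (a , b) +ᶜ (c , d) = a ℕ.+ c , b ℕ.+ d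
  (a , b) *ᶜ (c , d) = a ℕ.* c ℕ.+ b ℕ.* d , a ℕ.* d ℕ.+ b ℕ.* c

  coefficients : RawRing _ _
  coefficients = record
    { Carrier = ℕ × ℕ
    ; _≈_ = _≡_
    ; _+_ = λ p q → reduce (p +ᶜ q)
    ; _*_ = λ p q → reduce (p *ᶜ q)
    ; -_ = λ (a , b) → b , a
    ; 0# = 0 , 0
    ; 1# = 1 , 0
    }

  ι : ℕ → Carrier
  ι n = n ×′ 1#

  ι-homo-+ : ∀ m n → ι (m ℕ.+ n) ≈ ι m + ι n
  ι-homo-+ = ×-homo-+ 1#

  -‿interchange : ∀ w x y z → (w + x) - (y + z) ≈ (w - y) + (x - z)
  -‿interchange w x y z = begin
    (w + x) - (y + z)      ≈⟨ +-congˡ (⁻¹-∙-comm y z) ⟨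
    (w + x) + (- y - z)    ≈⟨ interchange w x (- y) (- z) ⟩
    (w - y) + (x - z)      ∎

  ι-homo-*+* : ∀ a b c d → ι (a ℕ.* c ℕ.+ b ℕ.* d) ≈ ι a * ι c + ι b * ι d
  ι-homo-*+* a b c d = trans (ι-homo-+ (a ℕ.* c) (b ℕ.* d)) (+-cong (×1-homo-* a c) (×1-homo-* b d))

  difference : ℕ × ℕ → Carrier
  difference (a , b) = ι a - ι b

  -- The first two clauses let the constants 0 and 1 of the solver denote 0# and
  -- 1# definitionally.
  ⟦_⟧ : ℕ × ℕ → Carrier
  ⟦ 0 , 0 ⟧ = 0#
  ⟦ 1 , 0 ⟧ = 1#
  ⟦ p ⟧     = difference p

  ⟦⟧≈difference : ∀ p → ⟦ p ⟧ ≈ difference p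
  ⟦⟧≈difference (0 , 0) = sym (-‿inverseʳ 0#)
  ⟦⟧≈difference (1 , 0) =
    sym (trans (+-cong (+-identityʳ 1#) -0#≈0#) (+-identityʳ 1#))
  ⟦⟧≈difference (0 , ℕ.suc b) = refl
  ⟦⟧≈difference (1 , ℕ.suc b) = refl
  ⟦⟧≈difference (ℕ.suc (ℕ.suc a) , b) = refl

  difference-homo-* : ∀ p q →
    difference (p *ᶜ q) ≈ difference p * difference q
  difference-homo-* (a , b) (c , d) = begin
    ι (a ℕ.* c ℕ.+ b ℕ.* d) - ι (a ℕ.* d ℕ.+ b ℕ.* c)
      ≈⟨ +-cong (ι-homo-*+* a b c d) (-‿cong (ι-homo-*+* a b d c)) ⟩
    (ι a * ι c + ι b * ι d) - (ι a * ι d + ι b * ι c)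
      ≈⟨ -‿interchange _ _ _ _ ⟩
    (ι a * ι c - ι a * ι d) + (ι b * ι d - ι b * ι c)
      ≈⟨ +-cong (x[y-z]≈xy-xz (ι a) (ι c) (ι d))
           (trans (-‿cong (x[y-z]≈xy-xz (ι b) (ι c) (ι d))) (⁻¹-anti-homo‿- _ _)) ⟨
    ι a * (ι c - ι d) - ι b * (ι c - ι d)
      ≈⟨ [y-z]x≈yx-zx (ι c - ι d) (ι a) (ι b) ⟨
    (ι a - ι b) * (ι c - ι d) ∎

  -- Adding `b` to both entries of the reduced pair gives, by `balance`, the same pair as adding
  -- `b ∸ a` to both entries of `(a , b)`.
  difference-reduce : ∀ p → difference (reduce p) ≈ difference p
  difference-reduce (a , b) = begin
    ι (a ℕ.∸ b) - ι (b ℕ.∸ a)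
      ≈⟨ trans (+-congˡ (-‿inverseʳ (ι b))) (+-identityʳ _) ⟨
    (ι (a ℕ.∸ b) - ι (b ℕ.∸ a)) + (ι b - ι b)
      ≈⟨ -‿interchange _ _ _ _ ⟨
    (ι (a ℕ.∸ b) + ι b) - (ι (b ℕ.∸ a) + ι b)
      ≈⟨ +-cong balance (-‿cong (+-comm _ _)) ⟩
    (ι a + ι (b ℕ.∸ a)) - (ι b + ι (b ℕ.∸ a))
      ≈⟨ -‿interchange _ _ _ _ ⟩
    (ι a - ι b) + (ι (b ℕ.∸ a) - ι (b ℕ.∸ a))
      ≈⟨ trans (+-congˡ (-‿inverseʳ _)) (+-identityʳ _) ⟩
    ι a - ι b ∎
    where
    balance : ι (a ℕ.∸ b) + ι b ≈ ι a + ι (b ℕ.∸ a)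
    balance = trans (sym (ι-homo-+ (a ℕ.∸ b) b)) (trans
      (×-congˡ (≡.trans (ℕ.+-comm (a ℕ.∸ b) b) (n+[m∸n]≡m+[n∸m] a b)))
      (ι-homo-+ a (b ℕ.∸ a)))

  morphism : coefficients -Raw-AlmostCommutative⟶ fromCommutativeRing R
  morphism = record
    { ⟦_⟧ = ⟦_⟧
    ; +-homo = λ p@(a , b) q@(c , d) → trans (⟦reduce⟧ (p +ᶜ q)) (trans
        (trans (+-cong (ι-homo-+ a c) (-‿cong (ι-homo-+ b d))) (-‿interchange _ _ _ _))
        (sym (+-cong (⟦⟧≈difference p) (⟦⟧≈difference q))))
    ; *-homo = λ p q → trans (⟦reduce⟧ (p *ᶜ q)) (trans (difference-homo-* p q)
        (sym (*-cong (⟦⟧≈difference p) (⟦⟧≈difference q))))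
    ; -‿homo = λ p@(a , b) → trans (⟦⟧≈difference (b , a)) (trans
        (sym (⁻¹-anti-homo‿- (ι a) (ι b)))
        (sym (-‿cong (⟦⟧≈difference p))))
    ; 0-homo = refl
    ; 1-homo = refl
    }
    where
    ⟦reduce⟧ : ∀ p → ⟦ reduce p ⟧ ≈ difference p
    ⟦reduce⟧ p = trans (⟦⟧≈difference (reduce p)) (difference-reduce p)

  _coeff≟_ : WeaklyDecidable (Induced-equivalence morphism)
  p coeff≟ q = Maybe.map (reflexive ∘ ≡.cong ⟦_⟧) (dec⇒maybe (≡-dec ℕ._≟_ ℕ._≟_ p q))

  open RingSolver coefficients (fromCommutativeRing R) morphism _coeff≟_ public
    using (solve; Polynomial; con; _:=_; _:+_; _:*_; _:-_; :-_)

  :0 : ∀ {n} → Polynomial n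
  :0 = con (0 , 0)

  :1 : ∀ {n} → Polynomial n
  :1 = con (1 , 0)

module Analysis (ℝ : CompleteOrderedField) where
  open CompleteOrderedField ℝ
  open OrderedFieldProperties ℝ
  open RealFunctions ℝ
  open Membership setoid using (_∈_)
  open import Algebra.Properties.Semiring.Mult semiring
    using (×-homo-+; ×-assoc-*; ×-congˡ) renaming (_×_ to _×′_)
  open IntegerCoefficients commutativeRing using (solve; _:=_; _:+_; _:*_; _:-_; :-_; :0; :1)

  -- The set contains 0, and contains 1 exactly when `S` holds. If its supremum is positive, some
  -- element exceeds 0 and carries a proof of `S`; otherwise 1 cannot be an element. This is what
  -- makes minima of sets of naturals exist.
  excluded-middle : (S : Set) → Dec S
  excluded-middle S
    with complete (λ x → x ≈ 0# ⊎ (x ≈ 1# × S)) (0# , inj₁ refl)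
      (1# , λ { (inj₁ x≈0)       → inj₁ (Order.<-respˡ-≈ (sym x≈0) 0<1)
              ; (inj₂ (x≈1 , _)) → inj₂ x≈1 })
  ... | σ , upper , approached with Order.compare 0# σ
  ... | tri< 0<σ _ _ with approached 0<σ
  ... | x , inj₁ x≈0 , 0<x     = contradiction 0<x (Order.irrefl (sym x≈0))
  ... | x , inj₂ (_ , s) , 0<x = yes s
  excluded-middle S | σ , upper , approached | tri≈ _ 0≈σ _ =
    no λ s → <⇒≱ 0<1 (≤-resp refl (sym 0≈σ) (upper (inj₂ (refl , s))))
  excluded-middle S | σ , upper , approached | tri> _ _ σ<0 =
    no λ s → <⇒≱ (Order.trans σ<0 0<1) (upper (inj₂ (refl , s)))

  -- Inequalities in an ordered field

  0≤y-x⇒x≤y : ∀ {x y} → 0# ≤ y - x → x ≤ y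
  0≤y-x⇒x≤y {x} {y} p = ≤-resp (+-identityˡ x) (cancel x y) (+-monoˡ-≤ x p)

  <⇒≉ : ∀ {x y} → x < y → ¬ x ≈ y
  <⇒≉ x<y x≈y = Order.irrefl x≈y x<y

  +-pos-nonneg : ∀ {x y} → 0# < x → 0# ≤ y → 0# < x + y
  +-pos-nonneg {x} {y} 0<x 0≤y = ≤-<-trans 0≤y
    (Order.<-respˡ-≈ (+-identityˡ y) (+-monoˡ-< y 0<x))

  +-nonneg : ∀ {x y} → 0# ≤ x → 0# ≤ y → 0# ≤ x + y
  +-nonneg 0≤x 0≤y = ≤-resp (+-identityʳ 0#) refl (+-mono-≤ 0≤x 0≤y)

  *-nonneg : ∀ {x y} → 0# ≤ x → 0# ≤ y → 0# ≤ x * y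
  *-nonneg {x} {y} 0≤x 0≤y = ≤-resp (zeroˡ y) refl (*-monoˡ-≤ 0≤y 0≤x)

  ⁻¹-pos : ∀ {x} → 0# < x → 0# < x ⁻¹
  ⁻¹-pos {x} 0<x with Order.compare 0# (x ⁻¹)
  ... | tri< 0<x⁻¹ _ _ = 0<x⁻¹
  ... | tri≈ _ 0≈x⁻¹ _ = contradiction
    (trans (sym (zeroʳ x)) (trans (*-congˡ 0≈x⁻¹) (*-inverseʳ (<⇒≉ 0<x ∘ sym)))) (<⇒≉ 0<1)
  ... | tri> _ _ x⁻¹<0 = contradiction 0<1 (Order.asym 1<0)
    where
    1<0 : 1# < 0#
    1<0 = <-resp (trans (*-comm _ _) (*-inverseʳ (<⇒≉ 0<x ∘ sym))) (zeroˡ x) (*-monoˡ-< 0<x x⁻¹<0)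

  -- Suprema, square roots and arc cosines

  supremum-least : ∀ {P s t} → IsSupremum P s → UpperBound P t → s ≤ t
  supremum-least {s = s} {t} (_ , approached) upper with Order.compare s t
  ... | tri< s<t _ _ = inj₁ s<t
  ... | tri≈ _ s≈t _ = inj₂ s≈t
  ... | tri> _ _ t<s = let _ , x∈P , t<x = approached t<s in contradiction (upper x∈P) (<⇒≱ t<x)

  -- `complete` carries no congruence law, so that `√` respects `≈` is derived from leastness: the
  -- set for `x` is contained in the set for `y`.
  √-mono : ∀ {x y} → x ≈ y → √ x ≤ √ y
  √-mono {x} {y} x≈y = supremum-least (proj₂ (sqrt-sup x)) λ where
    (inj₁ z≤0)  → proj₁ (proj₂ (sqrt-sup y)) (inj₁ z≤0)
    (inj₂ z²≤x) → proj₁ (proj₂ (sqrt-sup y)) (inj₂ (≤-resp refl x≈y z²≤x))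

  √-cong : ∀ {x y} → x ≈ y → √ x ≈ √ y
  √-cong x≈y = antisym (√-mono x≈y) (√-mono (sym x≈y))

  √-unique : ∀ {x y} → 0# ≤ y → y * y ≈ x → √ x ≈ y
  √-unique {x} {y} 0≤y y²≈x = antisym (supremum-least (proj₂ (sqrt-sup x)) upper)
    (proj₁ (proj₂ (sqrt-sup x)) (inj₂ (≤-reflexive y²≈x)))
    where
    upper : UpperBound (SqrtSet x) y
    upper (inj₁ z≤0) = ≤-trans z≤0 0≤y
    upper {z} (inj₂ z²≤x) with Order.compare z y
    ... | tri< z<y _ _ = inj₁ z<y
    ... | tri≈ _ z≈y _ = inj₂ z≈y
    ... | tri> _ _ y<z = contradiction (≤-resp refl (sym y²≈x) z²≤x)
      (<⇒≱ (≤-<-trans (≤-resp refl (*-comm z y) (*-monoˡ-≤ 0≤y (inj₁ y<z))) (*-monoˡ-< 0<z y<z)))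
      where
      0<z : 0# < z
      0<z = ≤-<-trans 0≤y y<z

  -- Only the outermost constructor mentions the left endpoint. The value is an index of the family,
  -- so moving the endpoint changes it to a new term `s′` that is merely `≈` to `s`.
  lowerSum-respˡ : ∀ {f a a′ b s} → a ≈ a′ → LowerSum f a b s → ∃[ s′ ] s ≈ s′ × LowerSum f a′ b s′
  lowerSum-respˡ a≈a′ (done a≈b) = 0# , refl , done (trans (sym a≈a′) a≈b)
  lowerSum-respˡ {a′ = a′} a≈a′ (step {s = s} c m a≤c m≤f ls) =
    m * (c - a′) + s , +-congʳ (*-congˡ (+-congˡ (-‿cong a≈a′))) ,
    step c m (≤-resp a≈a′ refl a≤c) (λ t a′≤t → m≤f t (≤-resp (sym a≈a′) refl a′≤t)) ls

  integral-monoˡ : ∀ {f bdd a a′ b} → a ≈ a′ → integral f bdd a b ≤ integral f bdd a′ b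
  integral-monoˡ {f} {bdd} {a} {a′} {b} a≈a′ =
    supremum-least (proj₂ (integral-sup f bdd a b)) λ where
      (inj₁ s≈0) → upper (inj₁ s≈0)
      (inj₂ ls)  → let _ , s≈s′ , ls′ = lowerSum-respˡ a≈a′ ls in
        ≤-trans (≤-reflexive s≈s′) (upper (inj₂ ls′))
    where
    upper : UpperBound (LowerSums f a′ b) (integral f bdd a′ b)
    upper = proj₁ (proj₂ (integral-sup f bdd a′ b))

  integral-congˡ : ∀ {f bdd a a′ b} → a ≈ a′ → integral f bdd a b ≈ integral f bdd a′ b
  integral-congˡ a≈a′ = antisym (integral-monoˡ a≈a′) (integral-monoˡ (sym a≈a′))

  integral-degenerate : ∀ {f bdd} a → integral f bdd a a ≤ 0#
  integral-degenerate {f} {bdd@(M , f≤M)} a =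
    supremum-least (proj₂ (integral-sup f bdd a a)) λ where
      (inj₁ s≈0) → ≤-reflexive s≈0
      (inj₂ ls)  → ≤-resp refl (trans (*-congˡ (-‿inverseʳ a)) (zeroʳ M)) (lowerSum-bounded f≤M ls)

  semicircle-zero : ∀ {x} → x * x ≈ 1# → semicircle x ≈ 0#
  semicircle-zero x²≈1 = √-unique ≤-refl
    (trans (zeroˡ 0#) (sym (trans (+-congˡ (-‿cong x²≈1)) (-‿inverseʳ 1#))))

  arccos-cong : ∀ {x y} → x ≈ y → arccos x ≈ arccos y
  arccos-cong x≈y = +-cong
    (*-cong x≈y (√-cong (+-congˡ (-‿cong (*-cong x≈y x≈y)))))
    (*-congˡ (integral-congˡ x≈y))

  -- This keeps zero angles out of the count: the term with the semicircle vanishes, and the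
  -- integral is over a degenerate interval.
  arccos-1≤0 : arccos 1# ≤ 0#
  arccos-1≤0 = ≤-resp (sym (+-congʳ (trans (*-congˡ (semicircle-zero (*-identityˡ 1#))) (zeroʳ 1#))))
    (trans (+-identityˡ _) (zeroʳ 2#))
    (+-mono-≤ (≤-refl {0#})
      (≤-resp (*-comm _ _) (*-comm _ _) (*-monoˡ-≤ 0≤2 (integral-degenerate 1#))))
    where
    0≤2 : 0# ≤ 2#
    0≤2 = inj₁ (+-pos-nonneg 0<1 (inj₁ 0<1))

  -- The integral term is `π` by definition, and the term with the semicircle vanishes at `- 1#`.
  arccos-‿1≈π : arccos (- 1#) ≈ π
  arccos-‿1≈π = trans (+-congʳ (trans (*-congˡ (semicircle-zero -1²≈1)) (zeroʳ _))) (+-identityˡ π)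
    where
    -1²≈1 : - 1# * - 1# ≈ 1#
    -1²≈1 = solve 0 ((:- :1) :* (:- :1) := :1) refl

  -- Angles through unit directions

  open Angles ℝ

  ·-comm : ∀ u v → u · v ≈ v · u
  ·-comm (a , b) (c , d) = +-cong (*-comm a c) (*-comm b d)

  -- A normalisation of `q -ₚ p` given in advance: the length `scale` is exhibited, so the square
  -- roots in `∠` are identified by `√-unique` and never computed.
  record Direction (p q a : Point) : Set where
    field
      scale    : Carrier
      positive : 0# < scale
      unit     : a · a ≈ 1#
      parallel : q -ₚ p ≈ₚ (scale * proj₁ a , scale * proj₂ a)

  norm-direction : ∀ {p q a} (d : Direction p q a) → ‖ q -ₚ p ‖ ≈ Direction.scale d
  norm-direction {a = a₁ , a₂} d = √-unique (inj₁ positive) (trans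
    (trans (sym (*-identityʳ _)) (*-congˡ (sym unit)))
    (trans (rearrange scale a₁ a₂)
      (sym (+-cong (*-cong p₁ p₁) (*-cong p₂ p₂)))))
    where
    open Direction d
    p₁ = proj₁ parallel
    p₂ = proj₂ parallel
    rearrange : ∀ l x y → l * l * (x * x + y * y) ≈ l * x * (l * x) + l * y * (l * y)
    rearrange = solve 3 (λ l x y →
      l :* l :* (x :* x :+ y :* y) := l :* x :* (l :* x) :+ l :* y :* (l :* y)) refl

  -- The two scales in the dot product cancel against the product of the norms.
  ∠-directions : ∀ {p q r a b} → Direction p q a → Direction p r b → ∠ q p r ≈ arccos (a · b)
  ∠-directions {p} {q} {r} {a₁ , a₂} {b₁ , b₂} d e = arccos-cong (trans
    (*-cong
      (+-cong (*-cong (proj₁ D.parallel) (proj₁ E.parallel))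
              (*-cong (proj₂ D.parallel) (proj₂ E.parallel)))
      (⁻¹-cong (*-cong (norm-direction d) (norm-direction e))))
    (trans (rearrange D.scale E.scale _ a₁ a₂ b₁ b₂)
      (trans (*-congʳ (*-inverseʳ (<⇒≉ (*-pos D.positive E.positive) ∘ sym))) (*-identityˡ _))))
    where
    module D = Direction d
    module E = Direction e
    rearrange : ∀ l m n a₁ a₂ b₁ b₂ →
      (l * a₁ * (m * b₁) + l * a₂ * (m * b₂)) * n ≈ l * m * n * (a₁ * b₁ + a₂ * b₂)
    rearrange = solve 7 (λ l m n a₁ a₂ b₁ b₂ →
      (l :* a₁ :* (m :* b₁) :+ l :* a₂ :* (m :* b₂)) :* n :=
      l :* m :* n :* (a₁ :* b₁ :+ a₂ :* b₂)) refl

  -- Orbits of rotations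

  a²+b²≈1⇒a≤1 : ∀ {a b} → a * a + b * b ≈ 1# → a ≤ 1#
  a²+b²≈1⇒a≤1 {a} {b} eq with Order.compare a 1#
  ... | tri< a<1 _ _ = inj₁ a<1
  ... | tri≈ _ a≈1 _ = inj₂ a≈1
  ... | tri> _ _ 1<a = contradiction
    (≤-resp (+-identityʳ _) eq (+-mono-≤ (≤-refl {a * a}) (x²≥0 b)))
    (<⇒≱ (1≤x<y⇒x<y² ≤-refl 1<a))

  module Orbit (c s : Carrier) (c²+s²≈1 : c * c + s * s ≈ 1#) where

    -- If `c` and `s` are the cosine and sine of φ, this is (cos kφ, sin kφ).
    orbit : ℕ → Point
    orbit ℕ.zero    = 1# , 0#
    orbit (ℕ.suc k) = let x , y = orbit k in c * x - s * y , c * y + s * x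

    x y : ℕ → Carrier
    x = proj₁ ∘ orbit
    y = proj₂ ∘ orbit

    unit : ∀ k → x k * x k + y k * y k ≈ 1#
    unit ℕ.zero    = solve 0 (:1 :* :1 :+ :0 :* :0 := :1) refl
    unit (ℕ.suc k) = trans (rearrange c s (x k) (y k)) (trans (*-cong c²+s²≈1 (unit k)) (*-identityˡ 1#))
      where
      rearrange : ∀ c s x y → (c * x - s * y) * (c * x - s * y) + (c * y + s * x) * (c * y + s * x)
                            ≈ (c * c + s * s) * (x * x + y * y)
      rearrange = solve 4 (λ c s x y →
        (c :* x :- s :* y) :* (c :* x :- s :* y) :+ (c :* y :+ s :* x) :* (c :* y :+ s :* x) :=
        (c :* c :+ s :* s) :* (x :* x :+ y :* y)) refl

    -- The addition formulas for cosine and sine.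
    orbit-+ : ∀ i d → orbit (i ℕ.+ d) ≈ₚ (x i * x d - y i * y d , x i * y d + y i * x d)
    orbit-+ ℕ.zero d =
      solve 2 (λ x y → x := :1 :* x :- :0 :* y) refl (x d) (y d) ,
      solve 2 (λ x y → y := :1 :* y :+ :0 :* x) refl (x d) (y d)
    orbit-+ (ℕ.suc i) d =
      trans (+-cong (*-congˡ (proj₁ ih)) (-‿cong (*-congˡ (proj₂ ih))))
        (solve 6 (λ c s x y u v →
          c :* (x :* u :- y :* v) :- s :* (x :* v :+ y :* u) :=
          (c :* x :- s :* y) :* u :- (c :* y :+ s :* x) :* v) refl c s (x i) (y i) (x d) (y d)) ,
      trans (+-cong (*-congˡ (proj₂ ih)) (*-congˡ (proj₁ ih)))
        (solve 6 (λ c s x y u v →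
          c :* (x :* v :+ y :* u) :+ s :* (x :* u :- y :* v) :=
          (c :* x :- s :* y) :* v :+ (c :* y :+ s :* x) :* u) refl c s (x i) (y i) (x d) (y d))
      where
      ih : orbit (i ℕ.+ d) ≈ₚ (x i * x d - y i * y d , x i * y d + y i * x d)
      ih = orbit-+ i d

    dot : ∀ i d → orbit i · orbit (i ℕ.+ d) ≈ x d
    dot i d = trans (+-cong (*-congˡ (proj₁ (orbit-+ i d))) (*-congˡ (proj₂ (orbit-+ i d))))
      (trans (solve 4 (λ x y u v →
          x :* (x :* u :- y :* v) :+ y :* (x :* v :+ y :* u) := (x :* x :+ y :* y) :* u)
          refl (x i) (y i) (x d) (y d))
        (trans (*-congʳ (unit i)) (*-identityˡ (x d))))

    -- The determinant of two orbit points is the sine of the angle between them. Its sign will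
    -- order the slopes.
    cross : ∀ i d → x i * y (i ℕ.+ d) - y i * x (i ℕ.+ d) ≈ y d
    cross i d = trans
      (+-cong (*-congˡ (proj₂ (orbit-+ i d))) (-‿cong (*-congˡ (proj₁ (orbit-+ i d)))))
      (trans (solve 4 (λ x y u v →
          x :* (x :* v :+ y :* u) :- y :* (x :* u :- y :* v) := (x :* x :+ y :* y) :* v)
          refl (x i) (y i) (x d) (y d))
        (trans (*-congʳ (unit i)) (*-identityˡ (y d))))

    -- One step of the rotation lowers x by at most 1 − c + s.
    x-lower : ∀ {ε} → 0# < s → (1# - c) + s ≤ ε → ∀ k → 1# ≤ x k + k ×′ ε
    x-lower 0<s ε-bound ℕ.zero       = ≤-reflexive (sym (+-identityʳ 1#))
    x-lower {ε} 0<s ε-bound (ℕ.suc k) = ≤-trans (x-lower 0<s ε-bound k) (0≤y-x⇒x≤y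
      -- The difference of the two bounds is a sum of three nonnegative terms: (1 - c)(1 - x), s(1 -
      -- y) and the slack in `ε-bound`.
      (≤-resp refl (rearrange c s (x k) (y k) ε (k ×′ ε))
        (+-nonneg (+-nonneg
          (*-nonneg (x≤y⇒0≤y-x (a²+b²≈1⇒a≤1 c²+s²≈1)) (x≤y⇒0≤y-x (a²+b²≈1⇒a≤1 (unit k))))
          (*-nonneg (inj₁ 0<s)
            (x≤y⇒0≤y-x (a²+b²≈1⇒a≤1 (trans (+-comm _ _) (unit k))))))
          (x≤y⇒0≤y-x ε-bound))))
      where
      rearrange : ∀ c s x y ε e →
        ((1# - c) * (1# - x) + s * (1# - y)) + (ε - ((1# - c) + s)) ≈
        ((c * x - s * y) + (ε + e)) - (x + e)
      rearrange = solve 6 (λ c s x y ε e →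
        ((:1 :- c) :* (:1 :- x) :+ s :* (:1 :- y)) :+ (ε :- ((:1 :- c) :+ s)) :=
        ((c :* x :- s :* y) :+ (ε :+ e)) :- (x :+ e)) refl

  -- A small rotation with rational cosine and sine

  ×-nonneg : ∀ n {x} → 0# ≤ x → 0# ≤ n ×′ x
  ×-nonneg ℕ.zero    0≤x = ≤-refl
  ×-nonneg (ℕ.suc n) 0≤x = +-nonneg 0≤x (×-nonneg n 0≤x)

  ×-pos : ∀ n {x} → 0# < x → 0# < ℕ.suc n ×′ x
  ×-pos n 0<x = +-pos-nonneg 0<x (×-nonneg n (inj₁ 0<x))

  -- The field `0<x` keeps the orbit points up to index `K` in the open right half-plane, so that
  -- their rays from the origin meet the vertical line through (1, 0).
  record SmallRotation (K : ℕ) : Set where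
    field
      c s      : Carrier
      c²+s²≈1  : c * c + s * s ≈ 1#
      0<s      : 0# < s
    open Orbit c s c²+s²≈1 public
    field
      0<x      : ∀ {k} → k ℕ.≤ K → 0# < x k

  -- Rational parametrisation of the circle: s = 2r/(1+r²), c = (1-r²)/(1+r²)
  -- with (K + 1)·4r = 1, where 1 − c + s ≤ 4r.
  smallRotation : ∀ K → SmallRotation K
  smallRotation K = record
    { c = c ; s = s ; c²+s²≈1 = c²+s²≈1 ; 0<s = 0<s ; 0<x = 0<x }
    where
    4# r D c s : Carrier
    4# = 2# + 2#
    r  = (ℕ.suc K ×′ 4#) ⁻¹
    D  = (1# + r * r) ⁻¹
    c  = (1# - r * r) * D
    s  = (r + r) * D

    0<2 : 0# < 2#
    0<2 = +-pos-nonneg 0<1 (inj₁ 0<1)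

    0<[K+1]4 : 0# < ℕ.suc K ×′ 4#
    0<[K+1]4 = ×-pos K (+-pos-nonneg 0<2 (inj₁ 0<2))

    0<r : 0# < r
    0<r = ⁻¹-pos 0<[K+1]4

    0<1+r² : 0# < 1# + r * r
    0<1+r² = +-pos-nonneg 0<1 (x²≥0 r)

    0<D : 0# < D
    0<D = ⁻¹-pos 0<1+r²

    [1+r²]D≈1 : (1# + r * r) * D ≈ 1#
    [1+r²]D≈1 = *-inverseʳ (<⇒≉ 0<1+r² ∘ sym)

    c²+s²≈1 : c * c + s * s ≈ 1#
    c²+s²≈1 = trans
      (solve 2 (λ r D →
        (:1 :- r :* r) :* D :* ((:1 :- r :* r) :* D) :+ (r :+ r) :* D :* ((r :+ r) :* D) :=
        (:1 :+ r :* r) :* D :* ((:1 :+ r :* r) :* D)) refl r D)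
      (trans (*-cong [1+r²]D≈1 [1+r²]D≈1) (*-identityˡ 1#))

    0<s : 0# < s
    0<s = *-pos (+-pos-nonneg 0<r (inj₁ 0<r)) 0<D

    ε : Carrier
    ε = 4# * r

    0<ε : 0# < ε
    0<ε = *-pos (+-pos-nonneg 0<2 (inj₁ 0<2)) 0<r

    ε-bound : (1# - c) + s ≤ ε
    ε-bound = 0≤y-x⇒x≤y (≤-resp refl (trans slack
        (+-cong (trans (*-congˡ [1+r²]D≈1) (*-identityʳ ε))
          (-‿cong (+-congʳ (+-congʳ [1+r²]D≈1)))))
      (inj₁ (*-pos 0<D (*-pos 0<r (+-pos-nonneg 0<1 (+-nonneg (x²≥0 (r - 1#))
        (+-nonneg (x²≥0 r) (+-nonneg (x²≥0 r) (x²≥0 r)))))))))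
      where
      -- With 1 written as (1 + r²)D, the slack is Dr(2 - 2r + 4r²). Writing the quadratic as 1 + (r
      -- - 1)² + 3r² makes its positivity visible.
      slack : D * (r * (1# + ((r - 1#) * (r - 1#) + (r * r + (r * r + r * r)))))
          ≈ ε * ((1# + r * r) * D) - (((1# + r * r) * D - c) + s)
      slack = solve 2 (λ r D →
        D :* (r :* (:1 :+ ((r :- :1) :* (r :- :1) :+ (r :* r :+ (r :* r :+ r :* r))))) :=
        ((:1 :+ :1) :+ (:1 :+ :1)) :* r :* ((:1 :+ r :* r) :* D)
          :- (((:1 :+ r :* r) :* D :- (:1 :- r :* r) :* D) :+ (r :+ r) :* D)) refl r D

    [K+1]ε≈1 : ℕ.suc K ×′ ε ≈ 1#
    [K+1]ε≈1 = trans (sym (×-assoc-* (ℕ.suc K) 4# r)) (*-inverseʳ (<⇒≉ 0<[K+1]4 ∘ sym))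

    k×ε<1 : ∀ {k} → k ℕ.≤ K → k ×′ ε < 1#
    k×ε<1 {k} k≤K with ℕ.m≤n⇒∃[o]m+o≡n k≤K
    ... | d , ≡.refl = <-resp (+-identityˡ _) eq (+-monoˡ-< (k ×′ ε) (×-pos d 0<ε))
      where
      eq : ℕ.suc d ×′ ε + k ×′ ε ≈ 1#
      eq = trans (+-comm _ _) (trans (sym (×-homo-+ ε k (ℕ.suc d)))
        (trans (×-congˡ (ℕ.+-suc k d)) [K+1]ε≈1))

    -- `x-lower` gives x k ≥ 1 - kε. The factor K + 1, rather than K, in the choice of `r` makes
    -- this strictly positive even at k = K.
    0<x : ∀ {k} → k ℕ.≤ K → 0# < Orbit.x c s c²+s²≈1 k
    0<x {k} k≤K = Order.<-respʳ-≈ x≈ (x<y⇒0<y-x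
      (<-≤-trans (k×ε<1 k≤K) (Orbit.x-lower c s c²+s²≈1 0<s ε-bound k)))
      where
      <-≤-trans : ∀ {x y z} → x < y → y ≤ z → x < z
      <-≤-trans x<y (inj₁ y<z) = Order.trans x<y y<z
      <-≤-trans x<y (inj₂ y≈z) = Order.<-respʳ-≈ y≈z x<y
      x≈ : (Orbit.x c s c²+s²≈1 k + k ×′ ε) - k ×′ ε ≈ Orbit.x c s c²+s²≈1 k
      x≈ = solve 2 (λ x e → (x :+ e) :- e := x) refl _ _

  -- Counting angles

  lookup-injective : ∀ {xs} → Unique setoid xs → ∀ i j → lookup xs i ≈ lookup xs j → i ≡ j
  lookup-injective (x∉xs ∷ xs!) Fin.zero    Fin.zero    _  = ≡.refl
  lookup-injective (x∉xs ∷ xs!) Fin.zero    (Fin.suc j) eq =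
    contradiction eq (All.lookup x∉xs (∈-lookup j))
  lookup-injective (x∉xs ∷ xs!) (Fin.suc i) Fin.zero    eq =
    contradiction (sym eq) (All.lookup x∉xs (∈-lookup i))
  lookup-injective (x∉xs ∷ xs!) (Fin.suc i) (Fin.suc j) eq =
    ≡.cong Fin.suc (lookup-injective xs! i j eq)

  -- Each position in `xs` is sent to the position of an equal element in `ys`. Uniqueness makes
  -- this map injective, and the pigeonhole principle applies.
  unique-length-≤ : ∀ {xs ys} → Unique setoid xs → All (_∈ ys) xs → length xs ℕ.≤ length ys
  unique-length-≤ {xs} xs! xs⊆ys = Fin.injective⇒≤
    {f = λ i → Any.index (xs∋ i)}
    (λ {i} {j} eq → lookup-injective xs! i j (index-injective setoid (xs∋ i) (xs∋ j) eq))
    where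
    xs∋ : ∀ i → lookup xs i ∈ _
    xs∋ i = All.lookup xs⊆ys (∈-lookup i)

  IsProper : Carrier → Set
  IsProper θ = 0# < θ × θ < π

  -- Coverage alone gives the upper bound: `ys` may repeat values or contain improper ones.
  A-≤ : ∀ {n} (P : Fin n → Point) i ys →
    (∀ j k → j ≢ i → k ≢ i → j ≢ k → IsProper (∠ (P j) (P i) (P k)) → ∠ (P j) (P i) (P k) ∈ ys) →
    A P i ℕ.≤ length ys
  A-≤ P i ys covered = unique-length-≤
    (deduplicate-! decSetoid (filter proper? (anglesAt P i)))
    (All.deduplicate⁺ Order._≟_ (All.zipWith (λ (cover , proper) → cover proper)
      (All.filter⁺ proper? anglesCovered , All.all-filter proper? (anglesAt P i))))
    where
    open StrictTotalOrder strictTotalOrder using (module Eq)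
    open Eq using (decSetoid)
    proper? : ∀ θ → Dec (IsProper θ)
    proper? θ = (0# Order.<? θ) ×-dec (θ Order.<? π)
    distinct? : ∀ jk → Dec (proj₁ jk ≢ i × proj₂ jk ≢ i × proj₁ jk ≢ proj₂ jk)
    distinct? (j , k) = ¬? (j Fin.≟ i) ×-dec ¬? (k Fin.≟ i) ×-dec ¬? (j Fin.≟ k)
    anglesCovered : All (λ θ → IsProper θ → θ ∈ ys) (anglesAt P i)
    anglesCovered = All.map⁺ {xs = filter distinct? (cartesianProduct (allFin _) (allFin _))}
      (All.map (λ {(j , k)} (j≢i , k≢i , j≢k) → covered j k j≢i k≢i j≢k)
        (All.all-filter distinct? (cartesianProduct (allFin _) (allFin _))))

  -- The apex is the origin, and the other points are the intersections of the
  -- line x = 1 with the rays through the points of the orbit.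
  module Configuration (m : ℕ) (rotation : SmallRotation (ℕ.suc m)) where
    open SmallRotation rotation

    n : ℕ
    n = ℕ.suc (ℕ.suc (ℕ.suc m))

    index≤ : (i : Fin (ℕ.suc (ℕ.suc m))) → toℕ i ℕ.≤ ℕ.suc m
    index≤ i = ℕ.s≤s⁻¹ (Fin.toℕ<n i)

    -- The tangent of `k` rotation steps.
    slope : ℕ → Carrier
    slope k = y k * x k ⁻¹

    point : Fin n → Point
    point Fin.zero    = 0# , 0#
    point (Fin.suc i) = 1# , slope (toℕ i)

    *-inverse-x : ∀ {k} → k ℕ.≤ ℕ.suc m → x k * x k ⁻¹ ≈ 1#
    *-inverse-x k≤ = *-inverseʳ (<⇒≉ (0<x k≤) ∘ sym)

    0<c : 0# < c
    0<c = Order.<-respʳ-≈ (solve 2 (λ c s → c :* :1 :- s :* :0 := c) refl c s) (0<x (ℕ.s≤s ℕ.z≤n))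

    0<y : ∀ {k} → k ℕ.≤ m → 0# < y (ℕ.suc k)
    0<y {ℕ.zero}  _   = Order.<-respʳ-≈ (solve 2 (λ c s → s := c :* :0 :+ s :* :1) refl c s) 0<s
    0<y {ℕ.suc k} k≤m = +-pos-nonneg (*-pos 0<c (0<y (ℕ.<⇒≤ k≤m)))
      (inj₁ (*-pos 0<s (0<x (ℕ.m≤n⇒m≤1+n k≤m))))

    -- The difference of tangents is sin((j - i)φ) / (cos iφ cos jφ), and all three factors are
    -- positive.
    slope-< : ∀ {i j} → i ℕ.< j → j ℕ.≤ ℕ.suc m → slope i < slope j
    slope-< {i} {j} i<j j≤ = 0<y-x⇒x<y (Order.<-respʳ-≈ difference
      (*-pos (*-pos (⁻¹-pos (0<x i≤)) (⁻¹-pos (0<x j≤))) (0<y (ℕ.s≤s⁻¹ (gap≤ i<j j≤)))))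
      where
      i≤ : i ℕ.≤ ℕ.suc m
      i≤ = ℕ.≤-trans (ℕ.<⇒≤ i<j) j≤
      d : ℕ
      d = proj₁ (gap i<j)
      cross′ : x i * y j - y i * x j ≈ y (ℕ.suc d)
      cross′ = ≡.subst (λ k → x i * y k - y i * x k ≈ y (ℕ.suc d)) (proj₂ (gap i<j))
        (cross i (ℕ.suc d))
      difference : x i ⁻¹ * x j ⁻¹ * y (ℕ.suc d) ≈ slope j - slope i
      difference = trans (*-congˡ (sym cross′)) (trans
        (solve 6 (λ x y x′ u v u′ → x′ :* u′ :* (x :* v :- y :* u)
            := v :* u′ :* (x :* x′) :- y :* x′ :* (u :* u′))
          refl (x i) (y i) (x i ⁻¹) (x j) (y j) (x j ⁻¹))
        (+-cong (trans (*-congˡ (*-inverse-x i≤)) (*-identityʳ _))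
          (-‿cong (trans (*-congˡ (*-inverse-x j≤)) (*-identityʳ _)))))

    point-injective : Injective {A = Fin n} _≡_ _≈ₚ_ point
    point-injective {Fin.zero}  {Fin.zero}  _         = ≡.refl
    point-injective {Fin.zero}  {Fin.suc j} (0≈1 , _) = contradiction 0≈1 (<⇒≉ 0<1)
    point-injective {Fin.suc i} {Fin.zero}  (1≈0 , _) = contradiction (sym 1≈0) (<⇒≉ 0<1)
    point-injective {Fin.suc i} {Fin.suc j} (_ , eq) with ℕ.<-cmp (toℕ i) (toℕ j)
    ... | tri< i<j _ _ = contradiction eq (<⇒≉ (slope-< i<j (index≤ j)))
    ... | tri≈ _ i≡j _ = ≡.cong Fin.suc (Fin.toℕ-injective i≡j)
    ... | tri> _ _ j<i = contradiction (sym eq) (<⇒≉ (slope-< j<i (index≤ i)))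

    -- The apex forces the constant `e` to vanish, the first point on the line then forces `a` to
    -- vanish, and the second, whose slope is positive, forces `b` to vanish.
    point-noncollinear : ¬ Collinear point
    point-noncollinear (a , b , e , ab≉0 , on-line) = ab≉0 (a≈0 , b≈0)
      where
      e≈0 : e ≈ 0#
      e≈0 = trans (sym (on-line Fin.zero)) (solve 2 (λ a b → a :* :0 :+ b :* :0 := :0) refl a b)
      a≈0 : a ≈ 0#
      a≈0 = trans
        -- The slope of the first point unfolds to `0# * 1# ⁻¹`; `w` stands for the inverse.
        (solve 3 (λ a b w → a := a :* :1 :+ b :* (:0 :* w)) refl a b (1# ⁻¹))
        (trans (on-line (Fin.suc Fin.zero)) e≈0)
      t : Carrier
      t = slope 1
      0<t : 0# < t
      0<t = Order.<-respˡ-≈ (zeroˡ _) (slope-< (ℕ.s≤s ℕ.z≤n) (ℕ.s≤s ℕ.z≤n))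
      bt≈0 : b * t ≈ 0#
      bt≈0 = trans (trans (sym (+-identityˡ (b * t))) (+-congʳ (sym (trans (*-congʳ a≈0) (zeroˡ 1#)))))
        (trans (on-line (Fin.suc (Fin.suc Fin.zero))) e≈0)
      b≈0 : b ≈ 0#
      b≈0 = trans (trans (sym (*-identityʳ b)) (*-congˡ (sym (*-inverseʳ (<⇒≉ 0<t ∘ sym)))))
        (trans (sym (*-assoc b t (t ⁻¹))) (trans (*-congʳ bt≈0) (zeroˡ _)))

    -- Unit directions between points of the configuration

    apex→ : ∀ i → Direction (point Fin.zero) (point (Fin.suc i)) (orbit (toℕ i))
    apex→ i = record
      -- The distance to the apex is the secant: the point is the orbit point divided by its first
      -- coordinate.
      { scale = x (toℕ i) ⁻¹
      ; positive = ⁻¹-pos (0<x (index≤ i))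
      ; unit = unit (toℕ i)
      ; parallel = trans (solve 0 (:1 :- :0 := :1) refl)
                     (trans (sym (*-inverse-x (index≤ i))) (*-comm _ _))
                 , solve 2 (λ y x′ → y :* x′ :- :0 := x′ :* y) refl _ _
      }

    →apex : ∀ i → Direction (point (Fin.suc i)) (point Fin.zero) (- x (toℕ i) , - y (toℕ i))
    →apex i = record
      { scale = x (toℕ i) ⁻¹
      ; positive = ⁻¹-pos (0<x (index≤ i))
      ; unit = trans (solve 2 (λ x y → (:- x) :* (:- x) :+ (:- y) :* (:- y) := x :* x :+ y :* y)
                        refl (x (toℕ i)) (y (toℕ i)))
                 (unit (toℕ i))
      ; parallel = trans (+-congˡ (-‿cong (sym (*-inverse-x (index≤ i)))))
                     (solve 2 (λ x x′ → :0 :- x :* x′ := x′ :* (:- x)) refl _ _)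
                 , solve 2 (λ y x′ → :0 :- y :* x′ := x′ :* (:- y)) refl _ _
      }

    upward downward : Point
    upward   = 0# , 1#
    downward = 0# , - 1#

    ↑ : ∀ {i j} → toℕ i ℕ.< toℕ j → Direction (point (Fin.suc i)) (point (Fin.suc j)) upward
    ↑ {i} {j} i<j = record
      { scale = slope (toℕ j) - slope (toℕ i)
      ; positive = x<y⇒0<y-x (slope-< i<j (index≤ j))
      ; unit = solve 0 (:0 :* :0 :+ :1 :* :1 := :1) refl
      ; parallel = trans (-‿inverseʳ 1#) (sym (zeroʳ _)) , sym (*-identityʳ _)
      }

    ↓ : ∀ {i j} → toℕ j ℕ.< toℕ i → Direction (point (Fin.suc i)) (point (Fin.suc j)) downward
    ↓ {i} {j} j<i = record
      { scale = slope (toℕ i) - slope (toℕ j)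
      ; positive = x<y⇒0<y-x (slope-< j<i (index≤ i))
      ; unit = solve 0 (:0 :* :0 :+ (:- :1) :* (:- :1) := :1) refl
      ; parallel = trans (-‿inverseʳ 1#) (sym (zeroʳ _))
                 , solve 2 (λ s t → t :- s := (s :- t) :* (:- :1)) refl _ _
      }

    -- This disposes of angles between two points of the line seen from a third: the unit directions
    -- are equal or opposite, with dot product 1 or -1.
    straight-improper : ∀ {θ z} → θ ≈ arccos z → z ≈ 1# ⊎ z ≈ - 1# → ¬ IsProper θ
    straight-improper θ≈ (inj₁ z≈1)  (0<θ , _) =
      <⇒≱ 0<θ (≤-resp (sym (trans θ≈ (arccos-cong z≈1))) refl arccos-1≤0)
    straight-improper θ≈ (inj₂ z≈-1) (_ , θ<π) =
      <⇒≉ θ<π (trans θ≈ (trans (arccos-cong z≈-1) arccos-‿1≈π))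

    side : ∀ {n} {i j : Fin n} → i ≢ j → toℕ i ℕ.< toℕ j ⊎ toℕ j ℕ.< toℕ i
    side {i = i} {j} i≢j with ℕ.<-cmp (toℕ i) (toℕ j)
    ... | tri< i<j _ _ = inj₁ i<j
    ... | tri≈ _ i≡j _ = contradiction (Fin.toℕ-injective i≡j) i≢j
    ... | tri> _ _ j<i = inj₂ j<i

    -- The case distinctions below go through [_,_]′ because with-abstraction
    -- would normalise goals that mention ∠, which is infeasible.
    A-apex : A point Fin.zero ℕ.≤ ℕ.suc m
    A-apex = ℕ.≤-trans (A-≤ point Fin.zero angles covered)
      (ℕ.≤-reflexive (length-tabulate angle))
      where
      angle : Fin (ℕ.suc m) → Carrier
      angle d = arccos (x (ℕ.suc (toℕ d)))
      angles : List Carrier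
      angles = tabulate angle
      -- By `dot` the angle depends only on the index difference `suc d`, and d ≤ m leaves `suc m`
      -- values. A general `z` serves both orders of the two points.
      ordered : ∀ {i j z} → i ℕ.< j → j ℕ.≤ ℕ.suc m → z ≈ orbit i · orbit j →
        arccos z ∈ angles
      ordered {i} {j} i<j j≤ z≈ = Any.tabulate⁺ {f = angle} (fromℕ< d<) (arccos-cong
        (trans (trans z≈ dot′) (reflexive (≡.cong (x ∘ ℕ.suc) (≡.sym (Fin.toℕ-fromℕ< d<))))))
        where
        d : ℕ
        d = proj₁ (gap i<j)
        d< : d ℕ.< ℕ.suc m
        d< = gap≤ i<j j≤
        dot′ : orbit i · orbit j ≈ x (ℕ.suc d)
        dot′ = ≡.subst (λ k → orbit i · orbit k ≈ x (ℕ.suc d)) (proj₂ (gap i<j))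
          (dot i (ℕ.suc d))
      covered : ∀ j k → j ≢ Fin.zero → k ≢ Fin.zero → j ≢ k →
        IsProper (∠ (point j) (point Fin.zero) (point k)) →
        ∠ (point j) (point Fin.zero) (point k) ∈ angles
      covered Fin.zero    _           j≢0 _   _   _ = contradiction ≡.refl j≢0
      covered (Fin.suc j) Fin.zero    _   k≢0 _   _ = contradiction ≡.refl k≢0
      covered (Fin.suc j) (Fin.suc k) _   _   j≢k _ =
        ∈-resp-≈ setoid (sym (∠-directions (apex→ j) (apex→ k)))
          ([ (λ j<k → ordered j<k (index≤ k) refl)
           , (λ k<j → ordered k<j (index≤ j) (·-comm (orbit (toℕ j)) (orbit (toℕ k))))
           ]′ (side (j≢k ∘ ≡.cong Fin.suc)))

    -- Angles at the vertices on the line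

    upAngle downAngle : ℕ → Carrier
    upAngle   i = arccos ((- x i , - y i) · upward)
    downAngle i = arccos ((- x i , - y i) · downward)

    -- Two points of the line give an improper angle, so every proper angle has the apex on one side
    -- and is `upAngle` or `downAngle`. Each membership is demanded only if some point lies on that
    -- side, so each end of the line gets by with a single angle.
    A-line : ∀ i ys →
      (∀ {j : Fin (ℕ.suc (ℕ.suc m))} → toℕ i ℕ.< toℕ j → upAngle (toℕ i) ∈ ys) →
      (∀ {j : Fin (ℕ.suc (ℕ.suc m))} → toℕ j ℕ.< toℕ i → downAngle (toℕ i) ∈ ys) →
      A point (Fin.suc i) ℕ.≤ length ys
    A-line i ys up∈ down∈ = A-≤ point (Fin.suc i) ys covered
      where
      side′ : ∀ {l} → Fin.suc l ≢ Fin.suc i → toℕ i ℕ.< toℕ l ⊎ toℕ l ℕ.< toℕ i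
      side′ l≢i = side (l≢i ∘ ≡.cong Fin.suc ∘ ≡.sym)

      covered : ∀ j k → j ≢ Fin.suc i → k ≢ Fin.suc i → j ≢ k →
        IsProper (∠ (point j) (point (Fin.suc i)) (point k)) →
        ∠ (point j) (point (Fin.suc i)) (point k) ∈ ys
      covered Fin.zero    Fin.zero    _   _   j≢k _ = contradiction ≡.refl j≢k
      covered Fin.zero    (Fin.suc k) _   k≢i _   _ =
        [ (λ i<k → ∈-resp-≈ setoid (sym (∠-directions (→apex i) (↑ i<k))) (up∈ i<k))
        , (λ k<i → ∈-resp-≈ setoid (sym (∠-directions (→apex i) (↓ k<i))) (down∈ k<i))
        ]′ (side′ k≢i)
      covered (Fin.suc j) Fin.zero    j≢i _   _   _ =
        [ (λ i<j → ∈-resp-≈ setoid (sym (trans (∠-directions (↑ i<j) (→apex i))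
            (arccos-cong (·-comm upward _)))) (up∈ i<j))
        , (λ j<i → ∈-resp-≈ setoid (sym (trans (∠-directions (↓ j<i) (→apex i))
            (arccos-cong (·-comm downward _)))) (down∈ j<i))
        ]′ (side′ j≢i)
      covered (Fin.suc j) (Fin.suc k) j≢i k≢i _ proper = contradiction proper
        ([ (λ i<j → [ (λ i<k → straight-improper (∠-directions (↑ i<j) (↑ i<k))
                        (inj₁ (solve 0 (:0 :* :0 :+ :1 :* :1 := :1) refl)))
                    , (λ k<i → straight-improper (∠-directions (↑ i<j) (↓ k<i))
                        (inj₂ (solve 0 (:0 :* :0 :+ :1 :* (:- :1) := :- :1) refl)))
                    ]′ (side′ k≢i))
         , (λ j<i → [ (λ i<k → straight-improper (∠-directions (↓ j<i) (↑ i<k))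
                        (inj₂ (solve 0 (:0 :* :0 :+ (:- :1) :* :1 := :- :1) refl)))
                    , (λ k<i → straight-improper (∠-directions (↓ j<i) (↓ k<i))
                        (inj₁ (solve 0 (:0 :* :0 :+ (:- :1) :* (:- :1) := :1) refl)))
                    ]′ (side′ k≢i))
         ]′ (side′ j≢i))

    A-line≤2 : ∀ i → A point (Fin.suc i) ℕ.≤ 2
    A-line≤2 i = A-line i (upAngle (toℕ i) ∷ downAngle (toℕ i) ∷ [])
      (λ _ → here refl) (λ _ → there (here refl))

    A-first≤1 : A point (Fin.suc Fin.zero) ℕ.≤ 1
    A-first≤1 = A-line Fin.zero (upAngle 0 ∷ []) (λ _ → here refl) (λ ())

    A-last≤1 : A point (Fin.suc (fromℕ (ℕ.suc m))) ℕ.≤ 1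
    A-last≤1 = A-line last (downAngle (toℕ last) ∷ [])
      (λ {j} last<j → contradiction (index≤ j) (ℕ.<⇒≱ (≡.subst (ℕ._< toℕ j) (Fin.toℕ-fromℕ _) last<j)))
      (λ _ → here refl)
      where
      last : Fin (ℕ.suc (ℕ.suc m))
      last = fromℕ (ℕ.suc m)

    -- The sum splits into the apex, the first point on the line, and the other `suc m` points on
    -- it, the last of which sees at most one angle.
    AΣ-point : AΣ point ℕ.≤ 3 ℕ.* n ℕ.∸ 6
    AΣ-point = ℕ.≤-trans
      (ℕ.+-mono-≤ A-apex (ℕ.+-mono-≤ A-first≤1 (sum-tabulate-≤ m (A-line≤2 ∘ Fin.suc) A-last≤1)))
      (ℕ.≤-reflexive (angle-count m))

  -- Excluded middle either yields a smaller element or certifies minimality. The descent is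
  -- structural in `bound`, which stays at least as large as the current element.
  minimum : {S : ℕ → Set} → ∀ {s} → S s → ∃[ m ] IsMinimum S m × m ℕ.≤ s
  minimum {S} {s} S∋s = go s s ℕ.≤-refl S∋s
    where
    go : ∀ bound s → s ℕ.≤ bound → S s → ∃[ m ] IsMinimum S m × m ℕ.≤ s
    go bound s s≤ S∋s with excluded-middle (∃[ t ] t ℕ.< s × S t)
    ... | no none = s , (S∋s , λ t S∋t → ℕ.≮⇒≥ λ t<s → none (t , t<s , S∋t)) , ℕ.≤-refl
    go ℕ.zero s s≤ S∋s | yes (t , t<s , S∋t) = contradiction (ℕ.≤-trans t<s s≤) λ ()
    go (ℕ.suc bound) s s≤ S∋s | yes (t , t<s , S∋t) =
      let m , min , m≤t = go bound t (ℕ.s≤s⁻¹ (ℕ.≤-trans t<s s≤)) S∋t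
      in m , min , ℕ.≤-trans m≤t (ℕ.<⇒≤ t<s)

open import Data.Nat.Base using (_≤_; _*_; _∸_)

theorem4p4 : (ℝ : CompleteOrderedField) → ∀ (n : ℕ) → 3 ≤ n →
    ∃[ m ] Angles.IsÂΣ ℝ n m × m ≤ 3 * n ∸ 6
theorem4p4 ℝ (ℕ.suc (ℕ.suc (ℕ.suc m))) _ =
  let k , isMinimum , k≤ = minimum {Angles.IsAngleSum ℝ n}
                             (point , point-injective , point-noncollinear , ≡.refl)
  in k , isMinimum , ℕ.≤-trans k≤ AΣ-point
  where
  open Analysis ℝ
  -- With n = 3 + m there are m + 2 points on the line, so the orbit indices run from 0 to `suc m`.
  open Configuration m (smallRotation (ℕ.suc m))
theorem4p4 ℝ 1 (ℕ.s≤s ())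
theorem4p4 ℝ 2 (ℕ.s≤s (ℕ.s≤s ()))
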